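{- For every integer $n\ge1$, the ascent generating polynomial of Motzkin sequences $\mathrm{asc}_{\mathcal{MP}(n)}(t)=\sum_{\mathbf w\in\mathcal{MP}(n)}t^{\mathrm{asc}(\mathbf w)}$ satisfies $$\mathrm{asc}_{\mathcal{MP}(n)}(t)=\sum_{i=0}^{\lfloor (n-1)/2\rfloor}\binom{n-1}{2i}C_i\,t^i={}_2F_1\!\left(\frac{1-n}{2},\frac{2-n}{2};2;4t\right),$$ where $C_i=\frac1{i+1}\binom{2i}{i}$ is the $i$th Catalan number.
   Context: $\mathcal{MP}(n)$ is the set of Motzkin sequences of size $n$: sequences $\mathbf w=(w_1,\dots,w_n)$ of positive integers with $w_1=w_n=1$ and $|w_i-w_{i+1}|\le1$ for $1\le i<n$. $\mathrm{asc}(\mathbf w)$ is the number of indices $i\in\{1,\dots,n-1\}$ with $w_i<w_{i+1}$. ${}_2F_1$ is the ordinary hypergeometric function (here a terminating series). -}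

module Defs where

open import Algebra.Definitions.RawSemiring using (_^_)
open import Data.Fin using (Fin; zero; suc; inject₁; fromℕ; toℕ)
open import Data.Fin.Induction using (<-weakInduction)
open import Data.Fin.Properties using (all?; toℕ≤pred[n]; toℕ-inject₁)
open import Data.Integer using (+_)
open import Data.List using (List; []; _∷_; map; foldr; filter; length; allFin; upTo; applyUpTo; cartesianProductWith)
open import Data.List.Membership.Propositional using (_∈_)
open import Data.List.Membership.Propositional.Properties
  using (∈-filter⁺; ∈-filter⁻; ∈-applyUpTo⁺; ∈-cartesianProductWith⁺)
open import Data.List.Relation.Unary.Any using (here)
open import Data.List.Relation.Unary.Unique.Propositional using (Unique; []; _∷_)
import Data.List.Relation.Unary.All as All
import Data.List.Relation.Unary.Unique.Propositional.Properties as Unique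
open import Data.Nat using (ℕ; zero; suc; _≤_; _≤?_; _<?_; _≟_; ∣_-_∣; s≤s; _!; NonZero)
import Data.Nat as ℕ
import Data.Nat.Properties as ℕ
open import Data.Nat.Combinatorics using (_C_)
open import Data.Product using (_,_; proj₂)
open import Data.Rational using (ℚ; 0ℚ; 1ℚ; _+_; _*_; _÷_; _/_; 1/_; +-*-rawSemiring; ≢-nonZero)
import Data.Rational as ℚ
import Data.Rational.Properties as ℚ
open import Data.Vec using (Vec; []; _∷_; lookup)
open import Data.Vec.Properties using (∷-injective)
open import Function using (_⇔_; mk⇔)
open import Relation.Binary.PropositionalEquality
  using (_≡_; _≢_; refl; sym; cong; module ≡-Reasoning)
open import Relation.Nullary using (Dec; does)
open import Relation.Nullary.Decidable using (map′; _×-dec_)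
open import Data.Bool using (if_then_else_)

-- Sequences (w₁,…,wₙ) with n = suc m, so that Fin (suc m) indexes the entries
-- and Fin m indexes the consecutive pairs (lookup w (inject₁ i) , lookup w (suc i)).

record IsMotzkin {m : ℕ} (w : Vec ℕ (suc m)) : Set where
  field
    positive : ∀ i → 1 ≤ lookup w i
    first    : lookup w zero ≡ 1
    last     : lookup w (fromℕ m) ≡ 1
    steps    : ∀ (i : Fin m) → ∣ lookup w (inject₁ i) - lookup w (suc i) ∣ ≤ 1

isMotzkin? : ∀ {m} (w : Vec ℕ (suc m)) → Dec (IsMotzkin w)
isMotzkin? {m} w = map′
  (λ { (p , f , l , s) → record { positive = p ; first = f ; last = l ; steps = s } })
  (λ M → let open IsMotzkin M in positive , first , last , steps)
  (all? (λ i → 1 ≤? lookup w i)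
    ×-dec (lookup w zero ≟ 1)
    ×-dec (lookup w (fromℕ m) ≟ 1)
    ×-dec all? (λ i → ∣ lookup w (inject₁ i) - lookup w (suc i) ∣ ≤? 1))

vectorsOver : {A : Set} → List A → ∀ n → List (Vec A n)
vectorsOver xs zero    = [] ∷ []
vectorsOver xs (suc n) = cartesianProductWith _∷_ xs (vectorsOver xs n)

-- Restricting the entries to {0,…,n} loses nothing, since wᵢ ≤ i;
-- ∈-MP⇔ and MP-unique state that MP n lists every Motzkin sequence exactly once.

MP : ∀ n .{{_ : NonZero n}} → List (Vec ℕ n)
MP n@(suc _) = filter isMotzkin? (vectorsOver (upTo (suc n)) n)

asc : ∀ {m} → Vec ℕ (suc m) → ℕ
asc {m} w = length (filter (λ i → lookup w (inject₁ i) <? lookup w (suc i)) (allFin m))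

vectorsOver-unique : {A : Set} {xs : List A} → Unique xs → ∀ n → Unique (vectorsOver xs n)
vectorsOver-unique u zero    = All.[] ∷ []
vectorsOver-unique u (suc n) =
  Unique.cartesianProductWith⁺ _∷_ ∷-injective u (vectorsOver-unique u n)

∈-vectorsOver : {A : Set} {xs : List A} {n : ℕ} (v : Vec A n) →
                (∀ i → lookup v i ∈ xs) → v ∈ vectorsOver xs n
∈-vectorsOver []      h = here refl
∈-vectorsOver (x ∷ v) h =
  ∈-cartesianProductWith⁺ _∷_ (h zero) (∈-vectorsOver v (λ i → h (suc i)))

entry-bound : ∀ {m} {w : Vec ℕ (suc m)} → IsMotzkin w → ∀ i → lookup w i ≤ suc (toℕ i)
entry-bound {m} {w} M = <-weakInduction (λ i → lookup w i ≤ suc (toℕ i))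
  (ℕ.≤-reflexive first) step
  where
  open IsMotzkin M
  open ℕ.≤-Reasoning
  step : ∀ i → lookup w (inject₁ i) ≤ suc (toℕ (inject₁ i)) → lookup w (suc i) ≤ suc (suc (toℕ i))
  step i ih = begin
    lookup w (suc i)
      ≤⟨ ℕ.m≤n+∣n-m∣ (lookup w (suc i)) (lookup w (inject₁ i)) ⟩
    lookup w (inject₁ i) ℕ.+ ∣ lookup w (inject₁ i) - lookup w (suc i) ∣
      ≤⟨ ℕ.+-mono-≤ ih (steps i) ⟩
    suc (toℕ (inject₁ i)) ℕ.+ 1
      ≡⟨ ℕ.+-comm (suc (toℕ (inject₁ i))) 1 ⟩
    suc (suc (toℕ (inject₁ i)))
      ≡⟨ cong (λ k → suc (suc k)) (toℕ-inject₁ i) ⟩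
    suc (suc (toℕ i)) ∎

∈-MP⇔ : ∀ {m} (w : Vec ℕ (suc m)) → w ∈ MP (suc m) ⇔ IsMotzkin w
∈-MP⇔ {m} w = mk⇔
  (λ w∈ → proj₂ (∈-filter⁻ isMotzkin? {xs = vectorsOver (upTo (suc (suc m))) (suc m)} w∈))
  (λ M → ∈-filter⁺ isMotzkin? (∈-vectorsOver w (λ i → ∈-applyUpTo⁺ (λ k → k)
           (s≤s (ℕ.≤-trans (entry-bound M i) (s≤s (toℕ≤pred[n] i)))))) M)

MP-unique : ∀ m → Unique (MP (suc m))
MP-unique m = Unique.filter⁺ isMotzkin?
  (vectorsOver-unique (Unique.upTo⁺ (suc (suc m))) (suc m))

ι : ℕ → ℚ
ι k = + k / 1

-- ℚ⟦t⟧ is the type of formal power series in t, given by their coefficients.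
-- ℚ[t] sits inside it, and f ≗ g is equality of series (for polynomials: of polynomials).

ℚ⟦t⟧ : Set
ℚ⟦t⟧ = ℕ → ℚ

infixl 6 _⊕_
infixr 7 _·_
infix 8 t^_

_⊕_ : ℚ⟦t⟧ → ℚ⟦t⟧ → ℚ⟦t⟧
(f ⊕ g) k = f k + g k

_·_ : ℚ → ℚ⟦t⟧ → ℚ⟦t⟧
(q · f) k = q * f k

t^_ : ℕ → ℚ⟦t⟧
(t^ j) k = if does (j ≟ k) then 1ℚ else 0ℚ

∑ : List ℚ⟦t⟧ → ℚ⟦t⟧
∑ = foldr _⊕_ (λ _ → 0ℚ)

-- f [ q ·t] is f(q t).
_[_·t] : ℚ⟦t⟧ → ℚ → ℚ⟦t⟧
(f [ q ·t]) k = _^_ +-*-rawSemiring q k * f k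

asc[MP_] : ∀ n .{{_ : NonZero n}} → ℚ⟦t⟧
asc[MP n@(suc _) ] = ∑ (map (λ w → t^ asc w) (MP n))

catalan : ℕ → ℚ
catalan i = (+ 1 / suc i) * ι ((2 ℕ.* i) C i)

-- The Pochhammer symbol (a)ₖ = a (a+1) ⋯ (a+k-1).
poch : ℚ → ℕ → ℚ
poch a zero    = 1ℚ
poch a (suc k) = poch a k * (a + ι k)

-- c ∉ {0, -1, -2, …}, the condition for ₂F₁(a,b;c;–) to be defined.
Admissible : ℚ → Set
Admissible c = ∀ k → c + ι k ≢ 0ℚ

*-≢0 : ∀ {p q} → p ≢ 0ℚ → q ≢ 0ℚ → p * q ≢ 0ℚ
*-≢0 {p} {q} p≢0 q≢0 pq≡0 = q≢0 (begin
  q                ≡⟨ sym (ℚ.*-identityˡ q) ⟩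
  1ℚ * q           ≡⟨ cong (_* q) (sym (ℚ.*-inverseˡ p)) ⟩
  (1/ p) * p * q   ≡⟨ ℚ.*-assoc (1/ p) p q ⟩
  (1/ p) * (p * q) ≡⟨ cong ((1/ p) *_) pq≡0 ⟩
  (1/ p) * 0ℚ      ≡⟨ ℚ.*-zeroʳ (1/ p) ⟩
  0ℚ ∎)
  where
  open ≡-Reasoning
  instance _ = ≢-nonZero p≢0

poch-≢0 : ∀ {c} → Admissible c → ∀ k → poch c k ≢ 0ℚ
poch-≢0 adm zero    = λ ()
poch-≢0 adm (suc k) = *-≢0 (poch-≢0 adm k) (adm k)

-- ∑ₖ (a)ₖ (b)ₖ / (c)ₖ · tᵏ / k!, which is a polynomial when a or b is in {0, -1, -2, …}.
₂F₁ : (a b c : ℚ) → .(Admissible c) → ℚ⟦t⟧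
₂F₁ a b c adm k =
  ((poch a k * poch b k) ÷ poch c k) {{≢-nonZero (poch-≢0 adm k)}}
    * (_/_ (+ 1) (k !) {{k ℕ.!≢0}})

ι2-admissible : Admissible (ι 2)
ι2-admissible k 2+k≡0 = ℚ.<⇒≢ 0<2+k (sym 2+k≡0)
  where
  0<2+k : 0ℚ ℚ.< ι 2 + ι k
  0<2+k = ℚ.+-mono-<-≤ {0ℚ} {ι 2} {0ℚ} {ι k} (ℚ.positive⁻¹ (ι 2))
            (ℚ.nonNegative⁻¹ (ι k) {{ℚ.normalize-nonNeg k 1}})

{-# OPTIONS --safe #-}
module Submission where

-- Counted by their k ascents, the paths from height j to 0 in m steps obey the
-- recurrence given by the first step. Choosing the m - (2k+j) places of the level steps
-- leaves a ballot path, so the count is C(m, 2k+j) times the ballot number of (j,k), and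
-- the recurrences for the two factors combine to the one for paths by Pascal's rule.
-- For j = 0 the ballot number is the Catalan number C_k.
-- On the hypergeometric side, with m = n - 1,
--   4ᵏ (-m/2)ₖ ((1-m)/2)ₖ = ∏_{i<k} (m-2i)(m-2i-1) = C(m,2k) (2k)!,
-- and dividing by (2)ₖ k! = (k+1)! k! turns (2k)! into C_k.

open import Defs
open import Algebra.Definitions.RawSemiring using (_^_)
open import Data.Bool using (true; false; if_then_else_)
open import Data.Fin using (Fin; zero; suc; inject₁; fromℕ)
open import Data.Integer using (+_; _-_)
import Data.Integer as ℤ
import Data.Integer.Properties as ℤ
open import Data.List using (List; []; _∷_; _++_; map; filter; length; tabulate; upTo)
open import Data.List.Membership.Propositional using (_∈_; _∉_)
open import Data.List.Membership.Propositional.Properties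
  using (∈-map⁺; ∈-map⁻; ∈-++⁺ˡ; ∈-++⁺ʳ; ∈-++⁻; ∈-filter⁺; ∈-filter⁻; ∈-upTo⁺; ∈-upTo⁻)
open import Data.List.Membership.Propositional.Properties.WithK using (unique∧set⇒bag)
open import Data.List.Properties using (filter-accept; filter-reject; length-++; length-map)
open import Data.List.Relation.Binary.BagAndSetEquality using (∼bag⇒↭)
open import Data.List.Relation.Binary.Disjoint.Propositional using (Disjoint)
open import Data.List.Relation.Binary.Permutation.Propositional using (_↭_)
open import Data.List.Relation.Binary.Permutation.Propositional.Properties using (↭-length)
import Data.List.Relation.Unary.All as All
open import Data.List.Relation.Unary.Any using (here; there)
open import Data.List.Relation.Unary.Unique.Propositional using (Unique; []; _∷_)
import Data.List.Relation.Unary.Unique.Propositional.Properties as Unique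
open import Data.Nat
  using (ℕ; zero; suc; _∸_; _≤_; _<_; _<?_; _≟_; ∣_-_∣; ⌊_/2⌋; z≤n; s≤s; _!; NonZero)
import Data.Nat as ℕ
open import Data.Nat.Combinatorics
  using (_C_; nCk+nC[k+1]≡[n+1]C[k+1]; nC1≡n; nCk≡n!/k![n-k]!; k![n∸k]!∣n!; k>n⇒nCk≡0)
open import Data.Nat.DivMod using (m/n*n≡m)
import Data.Nat.Properties as ℕ
open import Data.Nat.Solver renaming (module +-*-Solver to ℕ-Solver)
open import Data.Product using (_×_; _,_)
open import Data.Rational
  using (ℚ; 0ℚ; 1ℚ; _+_; _*_; _÷_; _/_; 1/_; -_; +-*-rawSemiring; ≢-nonZero; toℚᵘ)
import Data.Rational.Properties as ℚ
open import Data.Rational.Solver renaming (module +-*-Solver to ℚ-Solver)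
open import Data.Rational.Unnormalised using (mkℚᵘ; *≡*)
import Data.Rational.Unnormalised as ℚᵘ
import Data.Rational.Unnormalised.Properties as ℚᵘ
open import Data.Sum using (_⊎_; inj₁; inj₂)
open import Data.Vec using (Vec; []; _∷_; lookup)
open import Data.Vec.Properties using (∷-injectiveʳ)
open import Function using (_∘_; mk⇔; Equivalence)
open import Relation.Binary.PropositionalEquality
  using (_≡_; _≢_; _≗_; refl; sym; trans; cong; cong₂; subst; module ≡-Reasoning)
open import Relation.Nullary using (¬_; does; yes; no)
open import Relation.Nullary.Decidable using (dec-true; dec-false)
open import Relation.Unary using (Decidable)

-- Motzkin paths with a given number of ascents

-- For shifting indices: with `g = suc`, the ascents of `x ∷ y ∷ w` after the first pair become
-- those of `y ∷ w`.
length-filter-tabulate : ∀ {A B : Set} {P : B → Set} (P? : Decidable P) (g : A → B) {n} (f : Fin n → A) →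
  length (filter P? (tabulate (g ∘ f))) ≡ length (filter (P? ∘ g) (tabulate f))
length-filter-tabulate P? g {zero}  f = refl
length-filter-tabulate P? g {suc n} f with does (P? (g (f zero)))
... | true  = cong suc (length-filter-tabulate P? g (f ∘ suc))
... | false = length-filter-tabulate P? g (f ∘ suc)

module _ {m} {x y : ℕ} (w : Vec ℕ m) where

  private
    Ascent? : Decidable (λ i → lookup (x ∷ y ∷ w) (inject₁ i) < lookup (x ∷ y ∷ w) (suc i))
    Ascent? i = lookup (x ∷ y ∷ w) (inject₁ i) <? lookup (x ∷ y ∷ w) (suc i)

  asc-< : x < y → asc (x ∷ y ∷ w) ≡ suc (asc (y ∷ w))
  asc-< x<y = trans (cong length (filter-accept Ascent? {zero} {tabulate suc} x<y))
                    (cong suc (length-filter-tabulate Ascent? suc (λ i → i)))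

  asc-≮ : ¬ x < y → asc (x ∷ y ∷ w) ≡ asc (y ∷ w)
  asc-≮ x≮y = trans (cong length (filter-reject Ascent? {zero} {tabulate suc} x≮y))
                    (length-filter-tabulate Ascent? suc (λ i → i))

-- Path j k w: w has positive entries, starts at suc j, ends at 1, changes by at
-- most 1 in each step and has k ascents.
data Path : ∀ {m} → ℕ → ℕ → Vec ℕ (suc m) → Set where
  end   : Path 0 0 (1 ∷ [])
  up    : ∀ {m j k} {w : Vec ℕ (suc m)} → Path (suc j) k w → Path j (suc k) (suc j ∷ w)
  level : ∀ {m j k} {w : Vec ℕ (suc m)} → Path j k w → Path j k (suc j ∷ w)
  down  : ∀ {m j k} {w : Vec ℕ (suc m)} → Path j k w → Path (suc j) k (suc (suc j) ∷ w)

adjacent : ∀ a b → ∣ a - b ∣ ≤ 1 → b ≡ suc a ⊎ b ≡ a ⊎ a ≡ suc b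
adjacent zero    zero          _ = inj₂ (inj₁ refl)
adjacent zero    (suc zero)    _ = inj₁ refl
adjacent zero    (suc (suc b)) (s≤s ())
adjacent (suc zero) zero       _ = inj₂ (inj₂ refl)
adjacent (suc (suc a)) zero    (s≤s ())
adjacent (suc a) (suc b)       h with adjacent a b h
... | inj₁ refl        = inj₁ refl
... | inj₂ (inj₁ refl) = inj₂ (inj₁ refl)
... | inj₂ (inj₂ refl) = inj₂ (inj₂ refl)

path-first : ∀ {m j k} {w : Vec ℕ (suc m)} → Path j k w → lookup w zero ≡ suc j
path-first end       = refl
path-first (up _)    = refl
path-first (level _) = refl
path-first (down _)  = refl

path-last : ∀ {m j k} {w : Vec ℕ (suc m)} → Path j k w → lookup w (fromℕ m) ≡ 1
path-last end       = refl
path-last (up p)    = path-last p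
path-last (level p) = path-last p
path-last (down p)  = path-last p

path-positive : ∀ {m j k} {w : Vec ℕ (suc m)} → Path j k w → ∀ i → 1 ≤ lookup w i
path-positive end       zero    = s≤s z≤n
path-positive (up _)    zero    = s≤s z≤n
path-positive (up p)    (suc i) = path-positive p i
path-positive (level _) zero    = s≤s z≤n
path-positive (level p) (suc i) = path-positive p i
path-positive (down _)  zero    = s≤s z≤n
path-positive (down p)  (suc i) = path-positive p i

∣n-1+n∣≡1 : ∀ n → ∣ n - suc n ∣ ≡ 1
∣n-1+n∣≡1 n = trans (cong (∣ n -_∣) (ℕ.+-comm 1 n)) (ℕ.∣m-m+n∣≡n n 1)

path-steps : ∀ {m j k} {w : Vec ℕ (suc m)} → Path j k w →
  ∀ (i : Fin m) → ∣ lookup w (inject₁ i) - lookup w (suc i) ∣ ≤ 1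
path-steps (up {j = j} p) zero rewrite path-first p =
  ℕ.≤-reflexive (∣n-1+n∣≡1 j)
path-steps (up p) (suc i) = path-steps p i
path-steps (level {j = j} p) zero rewrite path-first p | ℕ.∣n-n∣≡0 j = z≤n
path-steps (level p) (suc i) = path-steps p i
path-steps (down {j = j} p) zero rewrite path-first p =
  ℕ.≤-reflexive (trans (ℕ.∣-∣-comm (suc j) j) (∣n-1+n∣≡1 j))
path-steps (down p) (suc i) = path-steps p i

path-asc : ∀ {m j k} {w : Vec ℕ (suc m)} → Path j k w → asc w ≡ k
path-asc end = refl
-- This fixes the second entry `y`, so that its comparison with the first entry is decided.
path-asc {j = j} (up {w = y ∷ w} p) with refl ← path-first p =
  trans (asc-< w ℕ.≤-refl) (cong suc (path-asc p))
path-asc (level {w = y ∷ w} p) with refl ← path-first p =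
  trans (asc-≮ w (ℕ.<-irrefl refl)) (path-asc p)
path-asc (down {w = y ∷ w} p) with refl ← path-first p =
  trans (asc-≮ w (ℕ.<-asym ℕ.≤-refl)) (path-asc p)

-- Converse of the `path-` lemmas above. As the ascent index is `asc w` itself, `Path 0 k w` holds
-- exactly for the Motzkin sequences `w` with `k` ascents.
path : ∀ {m} j (w : Vec ℕ (suc m)) → lookup w zero ≡ suc j → lookup w (fromℕ m) ≡ 1 →
  (∀ i → 1 ≤ lookup w i) → (∀ (i : Fin m) → ∣ lookup w (inject₁ i) - lookup w (suc i) ∣ ≤ 1) →
  Path j (asc w) w
path zero    (_ ∷ []) refl _  _ _ = end
path (suc _) (_ ∷ []) refl () _ _
path j (_ ∷ zero ∷ w) refl l pos st with () ← pos (suc zero)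
path j (_ ∷ suc i ∷ w) refl l pos st with adjacent j i (st zero)
... | inj₁ refl =
  subst (λ k → Path j k (suc j ∷ suc i ∷ w)) (sym (asc-< w ℕ.≤-refl))
    (up (path i (suc i ∷ w) refl l (pos ∘ suc) (st ∘ suc)))
... | inj₂ (inj₁ refl) =
  subst (λ k → Path j k (suc j ∷ suc i ∷ w)) (sym (asc-≮ w (ℕ.<-irrefl refl)))
    (level (path i (suc i ∷ w) refl l (pos ∘ suc) (st ∘ suc)))
... | inj₂ (inj₂ refl) =
  subst (λ k → Path j k (suc j ∷ suc i ∷ w)) (sym (asc-≮ w (ℕ.<-asym ℕ.≤-refl)))
    (down (path i (suc i ∷ w) refl l (pos ∘ suc) (st ∘ suc)))

-- Enumeration of the paths by their first step

-- `ups` and `downs` list the tails left by a first step up or down. They absorb the boundary cases,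
-- no ascent left and height 0, so that one clause of `paths` serves all `j` and `k`.
paths ups downs : ∀ m (j k : ℕ) → List (Vec ℕ (suc m))
paths zero    zero    zero    = (1 ∷ []) ∷ []
paths zero    zero    (suc _) = []
paths zero    (suc _) _       = []
paths (suc m) j       k       = map (suc j ∷_) (ups m j k ++ paths m j k ++ downs m j k)

ups m j zero    = []
ups m j (suc k) = paths m (suc j) k

downs m zero    k = []
downs m (suc j) k = paths m j k

∈-paths⁺ : ∀ {m j k} {w : Vec ℕ (suc m)} → Path j k w → w ∈ paths m j k
∈-paths⁺ end = here refl
∈-paths⁺ {suc m} {j} (up p) = ∈-map⁺ _ (∈-++⁺ˡ (∈-paths⁺ p))
∈-paths⁺ {suc m} {j} {k} (level p) = ∈-map⁺ _ (∈-++⁺ʳ (ups m j k) (∈-++⁺ˡ (∈-paths⁺ p)))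
∈-paths⁺ {suc m} {j} {k} (down p) =
  ∈-map⁺ _ (∈-++⁺ʳ (ups m j k) (∈-++⁺ʳ (paths m j k) (∈-paths⁺ p)))

∈-paths⁻ : ∀ m j k {w} → w ∈ paths m j k → Path j k w
∈-ups⁻ : ∀ m j k {w} → w ∈ ups m j k → Path j k (suc j ∷ w)
∈-downs⁻ : ∀ m j k {w} → w ∈ downs m j k → Path j k (suc j ∷ w)

∈-paths⁻ zero zero zero (here refl) = end
∈-paths⁻ (suc m) j k w∈ with ∈-map⁻ (suc j ∷_) w∈
... | v , v∈ , refl with ∈-++⁻ (ups m j k) v∈
...   | inj₁ v∈ups = ∈-ups⁻ m j k v∈ups
...   | inj₂ v∈rest with ∈-++⁻ (paths m j k) v∈rest
...     | inj₁ v∈paths = level (∈-paths⁻ m j k v∈paths)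
...     | inj₂ v∈downs = ∈-downs⁻ m j k v∈downs

∈-ups⁻ m j (suc k) w∈ = up (∈-paths⁻ m (suc j) k w∈)
∈-downs⁻ m (suc j) k w∈ = down (∈-paths⁻ m j k w∈)

∈-paths-first : ∀ m j k {w} → w ∈ paths m j k → lookup w zero ≡ suc j
∈-paths-first m j k w∈ = path-first (∈-paths⁻ m j k w∈)

∈-ups-first : ∀ m j k {w} → w ∈ ups m j k → lookup w zero ≡ suc (suc j)
∈-ups-first m j (suc k) = ∈-paths-first m (suc j) k

∈-downs-first : ∀ m j k {w} → w ∈ downs m j k → lookup w zero ≡ j
∈-downs-first m (suc j) k = ∈-paths-first m j k

-- The three blocks are disjoint because their tails start with different entries: `suc (suc j)`
-- after an up step, `suc j` after a level step, `j` after a down step.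
paths-unique : ∀ m j k → Unique (paths m j k)
ups-unique : ∀ m j k → Unique (ups m j k)
downs-unique : ∀ m j k → Unique (downs m j k)

paths-unique zero    zero    zero    = All.[] ∷ []
paths-unique zero    zero    (suc k) = []
paths-unique zero    (suc j) k       = []
paths-unique (suc m) j       k       = Unique.map⁺ ∷-injectiveʳ
  (Unique.++⁺ (ups-unique m j k)
    (Unique.++⁺ (paths-unique m j k) (downs-unique m j k) level#down) up#rest)
  where
  level#down : Disjoint (paths m j k) (downs m j k)
  level#down (l , d) = ℕ.1+n≢n (trans (sym (∈-paths-first m j k l)) (∈-downs-first m j k d))
  up#rest : Disjoint (ups m j k) (paths m j k ++ downs m j k)
  up#rest (u , r) with ∈-++⁻ (paths m j k) r
  ... | inj₁ l = ℕ.1+n≢n (trans (sym (∈-ups-first m j k u)) (∈-paths-first m j k l))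
  ... | inj₂ d = ℕ.m+1+n≢n 1 (trans (sym (∈-ups-first m j k u)) (∈-downs-first m j k d))

ups-unique m j zero    = []
ups-unique m j (suc k) = paths-unique m (suc j) k

downs-unique m zero    k = []
downs-unique m (suc j) k = paths-unique m j k

-- Two duplicate-free lists with the same members are permutations of each other, and so have equal
-- length.
MP-asc↭paths : ∀ m k → filter (λ w → asc w ≟ k) (MP (suc m)) ↭ paths m 0 k
MP-asc↭paths m k = ∼bag⇒↭ (unique∧set⇒bag
  (Unique.filter⁺ (λ w → asc w ≟ k) (MP-unique m)) (paths-unique m 0 k)
  (mk⇔ to from))
  where
  to : ∀ {w} → w ∈ filter (λ w → asc w ≟ k) (MP (suc m)) → w ∈ paths m 0 k
  to {w} w∈ with ∈-filter⁻ (λ w → asc w ≟ k) {xs = MP (suc m)} w∈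
  ... | w∈MP , refl = ∈-paths⁺ (path 0 w first last positive steps)
    where open IsMotzkin (Equivalence.to (∈-MP⇔ w) w∈MP)
  from : ∀ {w} → w ∈ paths m 0 k → w ∈ filter (λ w → asc w ≟ k) (MP (suc m))
  from {w} w∈ = ∈-filter⁺ (λ w → asc w ≟ k)
    (Equivalence.from (∈-MP⇔ w) record
      { positive = path-positive p ; first = path-first p
      ; last = path-last p ; steps = path-steps p })
    (path-asc p)
    where p = ∈-paths⁻ m 0 k w∈

-- Ballot numbers and the count of paths

-- The number of sequences of k up and k + j down steps that lead from height j
-- to 0 without going below 0.
ballot : ℕ → ℕ → ℕ
ballot j       zero    = 1
ballot zero    (suc k) = ballot 1 k
ballot (suc j) (suc k) = ballot (suc (suc j)) k ℕ.+ ballot j (suc k)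

-- Exposes a successor in the number of up and down steps; what remains is that number after a first
-- step up, from height `j + 1` with `k` ascents to come.
2[1+k]+j : ∀ j k → 2 ℕ.* suc k ℕ.+ j ≡ suc (2 ℕ.* k ℕ.+ suc j)
2[1+k]+j = solve 2 (λ j k → con 2 :* (con 1 :+ k) :+ j := con 1 :+ (con 2 :* k :+ (con 1 :+ j))) refl
  where open ℕ-Solver

-- Here `s` counts the steps that are not level. It is a variable with an equation so that each case
-- can bring it into the form `suc r`.
length-paths : ∀ m j k {s} → 2 ℕ.* k ℕ.+ j ≡ s → length (paths m j k) ≡ (m C s) ℕ.* ballot j k
length-paths zero zero    zero    refl = refl
length-paths zero zero    (suc k) refl = refl
-- The rewrite shows `s` to be a successor, so that `0 C s` computes to 0.
length-paths zero (suc j) k       refl rewrite ℕ.+-suc (2 ℕ.* k) j = refl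
length-paths (suc m) j k {s} eq = begin
  length (map (suc j ∷_) (ups m j k ++ paths m j k ++ downs m j k))
    ≡⟨ length-map (suc j ∷_) (ups m j k ++ paths m j k ++ downs m j k) ⟩
  length (ups m j k ++ paths m j k ++ downs m j k)
    ≡⟨ length-++ (ups m j k) ⟩
  length (ups m j k) ℕ.+ length (paths m j k ++ downs m j k)
    ≡⟨ cong (length (ups m j k) ℕ.+_) (length-++ (paths m j k)) ⟩
  length (ups m j k) ℕ.+ (length (paths m j k) ℕ.+ length (downs m j k))
    ≡⟨ cong (λ l → length (ups m j k) ℕ.+ (l ℕ.+ length (downs m j k))) (length-paths m j k eq) ⟩
  length (ups m j k) ℕ.+ ((m C s) ℕ.* ballot j k ℕ.+ length (downs m j k))
    ≡⟨ pascal j k eq ⟩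
  (suc m C s) ℕ.* ballot j k ∎
  where
  open ≡-Reasoning
  open ℕ-Solver
  -- The cases are those of `ballot`: no up step for `k = 0`, no down step for `j = 0`. A level step
  -- keeps `s`, which gives the summand with `m C s`.
  pascal : ∀ j k {s} → 2 ℕ.* k ℕ.+ j ≡ s →
    length (ups m j k) ℕ.+ ((m C s) ℕ.* ballot j k ℕ.+ length (downs m j k)) ≡ (suc m C s) ℕ.* ballot j k
  pascal zero zero refl = refl
  pascal (suc j) zero refl rewrite length-paths m j 0 refl = trans
    (solve 2 (λ a b → b :* con 1 :+ a :* con 1 := (a :+ b) :* con 1) refl (m C j) (m C suc j))
    (cong (ℕ._* 1) (nCk+nC[k+1]≡[n+1]C[k+1] m j))
  pascal zero (suc k) eq with r ← 2 ℕ.* k ℕ.+ 1 in r≡ | refl ← trans (sym eq) (2[1+k]+j 0 k)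
    rewrite length-paths m 1 k r≡ = trans
    (solve 3 (λ a b x → a :* x :+ (b :* x :+ con 0) := (a :+ b) :* x) refl
      (m C r) (m C suc r) (ballot 1 k))
    (cong (ℕ._* ballot 1 k) (nCk+nC[k+1]≡[n+1]C[k+1] m r))
  -- Up and down both leave `r` steps that are not level, so both counts carry the factor `m C r`,
  -- and the two ballot numbers add up to `ballot (suc j) (suc k)`.
  pascal (suc j) (suc k) eq with r ← 2 ℕ.* k ℕ.+ suc (suc j) in r≡ | refl ← trans (sym eq) (2[1+k]+j (suc j) k)
    rewrite length-paths m (suc (suc j)) k r≡
          | length-paths m j (suc k) (trans (2[1+k]+j j k) (trans (sym (ℕ.+-suc (2 ℕ.* k) (suc j))) r≡)) = trans
    (solve 4 (λ a b x y → a :* x :+ (b :* (x :+ y) :+ a :* y) := (a :+ b) :* (x :+ y)) refl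
      (m C r) (m C suc r) (ballot (suc (suc j)) k) (ballot j (suc k)))
    (cong (ℕ._* ballot (suc j) (suc k)) (nCk+nC[k+1]≡[n+1]C[k+1] m r))

-- The classical value (j+1)/(k+j+1) times the binomial coefficient of 2k+j over k, with
-- denominators cleared. It follows by induction along the recurrence of `ballot`.
ballot-! : ∀ j k {s t} → 2 ℕ.* k ℕ.+ j ≡ s → suc (k ℕ.+ j) ≡ t →
  ballot j k ℕ.* (k ! ℕ.* t !) ≡ suc j ℕ.* s !
ballot-! j zero refl refl =
  solve 2 (λ j f → con 1 :* (con 1 :* ((con 1 :+ j) :* f)) := (con 1 :+ j) :* f) refl j (j !)
  where open ℕ-Solver
ballot-! zero (suc k) {t = t} s≡ t≡ with refl ← trans (sym s≡) (2[1+k]+j 0 k) = begin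
  b ℕ.* (suc k ℕ.* k ! ℕ.* t !)
    ≡⟨ solve 4 (λ b k f g → b :* ((con 1 :+ k) :* f :* g) := (con 1 :+ k) :* (b :* (f :* g)))
         refl b k (k !) (t !) ⟩
  suc k ℕ.* (b ℕ.* (k ! ℕ.* t !))
    ≡⟨ cong (suc k ℕ.*_) (ballot-! 1 k refl (trans (cong suc (ℕ.+-suc k 0)) t≡)) ⟩
  suc k ℕ.* (2 ℕ.* (2 ℕ.* k ℕ.+ 1) !)
    ≡⟨ solve 2 (λ k f → (con 1 :+ k) :* (con 2 :* f) := con 1 :* ((con 1 :+ (con 2 :* k :+ con 1)) :* f))
         refl k ((2 ℕ.* k ℕ.+ 1) !) ⟩
  1 ℕ.* (suc (2 ℕ.* k ℕ.+ 1) ℕ.* (2 ℕ.* k ℕ.+ 1) !) ∎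
  where
  open ≡-Reasoning
  open ℕ-Solver
  b = ballot 1 k
ballot-! (suc j) (suc k) s≡ t≡
  with refl ← trans (sym s≡) (2[1+k]+j (suc j) k)
     | refl ← trans (sym t≡) (cong (λ l → suc (suc l)) (ℕ.+-suc k j)) = begin
  (b₁ ℕ.+ b₂) ℕ.* ((suc k ℕ.* f) ℕ.* (suc u ℕ.* g))
    -- The induction hypothesis for `b₁` has `k !` in place of `suc k !`, the one for `b₂` has `u !`
    -- in place of `suc u !`. The factors `suc k` and `suc u` are what is left over.
    ≡⟨ solve 6 (λ b₁ b₂ k f u g →
         (b₁ :+ b₂) :* (((con 1 :+ k) :* f) :* ((con 1 :+ u) :* g))
         := (con 1 :+ k) :* (b₁ :* (f :* ((con 1 :+ u) :* g)))
            :+ (con 1 :+ u) :* (b₂ :* (((con 1 :+ k) :* f) :* g))) refl b₁ b₂ k f u g ⟩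
  suc k ℕ.* (b₁ ℕ.* (f ℕ.* (suc u ℕ.* g))) ℕ.+ suc u ℕ.* (b₂ ℕ.* ((suc k ℕ.* f) ℕ.* g))
    ≡⟨ cong₂ (λ x y → suc k ℕ.* x ℕ.+ suc u ℕ.* y)
         (ballot-! (suc (suc j)) k refl
           (trans (cong suc (ℕ.+-suc k (suc j))) (cong (λ l → suc (suc l)) (ℕ.+-suc k j))))
         (ballot-! j (suc k) (trans (2[1+k]+j j k) (sym (ℕ.+-suc (2 ℕ.* k) (suc j)))) refl) ⟩
  suc k ℕ.* ((3 ℕ.+ j) ℕ.* h) ℕ.+ suc u ℕ.* (suc j ℕ.* h)
    -- `suc u` is written out as 3 + k + j, since the identity (k+1)(j+3) + (k+j+3)(j+1) =
    -- (j+2)(2k+j+3) depends on it.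
    ≡⟨ solve 3 (λ k j h →
         (con 1 :+ k) :* ((con 3 :+ j) :* h) :+ (con 3 :+ (k :+ j)) :* ((con 1 :+ j) :* h)
         := (con 2 :+ j) :* ((con 1 :+ (con 2 :* k :+ (con 2 :+ j))) :* h)) refl k j h ⟩
  suc (suc j) ℕ.* (suc (2 ℕ.* k ℕ.+ suc (suc j)) ℕ.* h) ∎
  where
  open ≡-Reasoning
  open ℕ-Solver
  b₁ = ballot (suc (suc j)) k
  b₂ = ballot j (suc k)
  u = suc (suc (k ℕ.+ j))
  f = k !
  g = u !
  h = (2 ℕ.* k ℕ.+ suc (suc j)) !

-- Binomial coefficients and factorials

-- The relation (n-k) C(n,k) = (k+1) C(n,k+1) with the subtraction moved across, so that it holds in
-- ℕ for every `k`. The induction uses Pascal's rule on both binomials.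
C-absorb : ∀ n k → n ℕ.* (n C k) ≡ suc k ℕ.* (n C suc k) ℕ.+ k ℕ.* (n C k)
C-absorb zero    zero    = refl
C-absorb zero    (suc k) rewrite ℕ.*-zeroʳ k = refl
C-absorb (suc n) zero    rewrite nC1≡n (suc n) = solve 1 (λ n → n :* con 1 := con 1 :* n :+ con 0) refl (suc n)
  where open ℕ-Solver
C-absorb (suc n) (suc k)
  rewrite sym (nCk+nC[k+1]≡[n+1]C[k+1] n k) | sym (nCk+nC[k+1]≡[n+1]C[k+1] n (suc k)) = begin
  suc n ℕ.* (a ℕ.+ b)
    ≡⟨ solve 3 (λ n a b → (con 1 :+ n) :* (a :+ b) := (n :* a :+ n :* b) :+ (a :+ b)) refl n a b ⟩
  (n ℕ.* a ℕ.+ n ℕ.* b) ℕ.+ (a ℕ.+ b)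
    ≡⟨ cong₂ (λ x y → (x ℕ.+ y) ℕ.+ (a ℕ.+ b)) (C-absorb n k) (C-absorb n (suc k)) ⟩
  _ ≡⟨ solve 4 (λ k a b c →
         (((con 1 :+ k) :* b :+ k :* a) :+ ((con 2 :+ k) :* c :+ (con 1 :+ k) :* b)) :+ (a :+ b)
         := (con 2 :+ k) :* (b :+ c) :+ (con 1 :+ k) :* (a :+ b)) refl k a b c ⟩
  suc (suc k) ℕ.* (b ℕ.+ c) ℕ.+ suc k ℕ.* (a ℕ.+ b) ∎
  where
  open ≡-Reasoning
  open ℕ-Solver
  a = n C k
  b = n C suc k
  c = n C suc (suc k)

2kCk-! : ∀ k → ((2 ℕ.* k) C k) ℕ.* (k ! ℕ.* k !) ≡ (2 ℕ.* k) !
2kCk-! k = begin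
  ((2 ℕ.* k) C k) ℕ.* (k ! ℕ.* k !)
    ≡⟨ cong (λ l → ((2 ℕ.* k) C k) ℕ.* (k ! ℕ.* l !)) (sym 2k∸k≡k) ⟩
  ((2 ℕ.* k) C k) ℕ.* (k ! ℕ.* (2 ℕ.* k ℕ.∸ k) !)
    ≡⟨ cong (ℕ._* (k ! ℕ.* (2 ℕ.* k ℕ.∸ k) !)) (nCk≡n!/k![n-k]! k≤2k) ⟩
  _ ≡⟨ m/n*n≡m (k![n∸k]!∣n! k≤2k) ⟩
  (2 ℕ.* k) ! ∎
  where
  open ≡-Reasoning
  instance _ = k ℕ.!* (2 ℕ.* k ℕ.∸ k) !≢0
  k≤2k : k ≤ 2 ℕ.* k
  k≤2k = ℕ.m≤m+n k _
  2k∸k≡k : 2 ℕ.* k ℕ.∸ k ≡ k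
  2k∸k≡k = trans (ℕ.m+n∸m≡n k (k ℕ.+ 0)) (ℕ.+-identityʳ k)

-- Coefficients over ℚ

-- Lets equations between fractions be checked on unnormalised representatives, where they are
-- integer identities free of any gcd.
toℚᵘ-/ : ∀ i d → toℚᵘ (i / suc d) ℚᵘ.≃ mkℚᵘ i d
toℚᵘ-/ i d = ℚ.toℚᵘ-fromℚᵘ (mkℚᵘ i d)

/1-homo-+ : ∀ i j → (i ℤ.+ j) / 1 ≡ i / 1 + j / 1
/1-homo-+ i j = ℚ.toℚᵘ-injective (begin
  toℚᵘ ((i ℤ.+ j) / 1)           ≈⟨ toℚᵘ-/ (i ℤ.+ j) 0 ⟩
  mkℚᵘ (i ℤ.+ j) 0
    ≈⟨ *≡* (cong (ℤ._* + 1) (sym (cong₂ ℤ._+_ (ℤ.*-identityʳ i) (ℤ.*-identityʳ j)))) ⟩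
  mkℚᵘ i 0 ℚᵘ.+ mkℚᵘ j 0         ≈⟨ ℚᵘ.+-cong (toℚᵘ-/ i 0) (toℚᵘ-/ j 0) ⟨
  toℚᵘ (i / 1) ℚᵘ.+ toℚᵘ (j / 1) ≈⟨ ℚ.toℚᵘ-homo-+ (i / 1) (j / 1) ⟨
  toℚᵘ (i / 1 + j / 1)           ∎)
  where open ℚᵘ.≃-Reasoning

/1-homo-* : ∀ i j → (i ℤ.* j) / 1 ≡ i / 1 * (j / 1)
/1-homo-* i j = ℚ.toℚᵘ-injective (begin
  toℚᵘ ((i ℤ.* j) / 1)           ≈⟨ toℚᵘ-/ (i ℤ.* j) 0 ⟩
  mkℚᵘ i 0 ℚᵘ.* mkℚᵘ j 0         ≈⟨ ℚᵘ.*-cong (toℚᵘ-/ i 0) (toℚᵘ-/ j 0) ⟨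
  toℚᵘ (i / 1) ℚᵘ.* toℚᵘ (j / 1) ≈⟨ ℚ.toℚᵘ-homo-* (i / 1) (j / 1) ⟨
  toℚᵘ (i / 1 * (j / 1))         ∎)
  where open ℚᵘ.≃-Reasoning

ι-+ : ∀ a b → ι (a ℕ.+ b) ≡ ι a + ι b
ι-+ a b = /1-homo-+ (+ a) (+ b)

ι-* : ∀ a b → ι (a ℕ.* b) ≡ ι a * ι b
ι-* a b = trans (cong (_/ 1) (ℤ.pos-* a b)) (/1-homo-* (+ a) (+ b))

d*[i/d]≡i : ∀ i d .{{_ : NonZero d}} → ι d * (i / d) ≡ i / 1
d*[i/d]≡i i (suc d) = ℚ.toℚᵘ-injective (begin
  toℚᵘ (ι (suc d) * (i / suc d))           ≈⟨ ℚ.toℚᵘ-homo-* (ι (suc d)) (i / suc d) ⟩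
  toℚᵘ (ι (suc d)) ℚᵘ.* toℚᵘ (i / suc d)   ≈⟨ ℚᵘ.*-cong (toℚᵘ-/ (+ suc d) 0) (toℚᵘ-/ i d) ⟩
  mkℚᵘ (+ suc d) 0 ℚᵘ.* mkℚᵘ i d           ≈⟨ *≡* (trans (ℤ.*-identityʳ _) (trans (ℤ.*-comm (+ suc d) i)
                                                (cong (λ e → i ℤ.* + suc e) (sym (ℕ.+-identityʳ d))))) ⟩
  mkℚᵘ i 0                                 ≈⟨ toℚᵘ-/ i 0 ⟨
  toℚᵘ (i / 1)                             ∎)
  where open ℚᵘ.≃-Reasoning

*-cancelˡ : ∀ {r p q} → r ≢ 0ℚ → r * p ≡ r * q → p ≡ q
*-cancelˡ {r} {p} {q} r≢0 eq = begin
  p               ≡⟨ undo p ⟨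
  1/ r * (r * p)  ≡⟨ cong (1/ r *_) eq ⟩
  1/ r * (r * q)  ≡⟨ undo q ⟩
  q               ∎
  where
  open ≡-Reasoning
  instance _ = ≢-nonZero r≢0
  undo : ∀ x → 1/ r * (r * x) ≡ x
  undo x = trans (sym (ℚ.*-assoc (1/ r) r x)) (trans (cong (_* x) (ℚ.*-inverseˡ r)) (ℚ.*-identityˡ x))

*-÷ : ∀ p q (q≢0 : q ≢ 0ℚ) → q * (p ÷ q) {{≢-nonZero q≢0}} ≡ p
*-÷ p q q≢0 = begin
  q * (p * 1/ q)  ≡⟨ cong (q *_) (ℚ.*-comm p (1/ q)) ⟩
  q * (1/ q * p)  ≡⟨ ℚ.*-assoc q (1/ q) p ⟨
  q * 1/ q * p    ≡⟨ cong (_* p) (ℚ.*-inverseʳ q) ⟩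
  1ℚ * p          ≡⟨ ℚ.*-identityˡ p ⟩
  p               ∎
  where
  open ≡-Reasoning
  instance _ = ≢-nonZero q≢0

ι-≢0 : ∀ n .{{_ : NonZero n}} → ι n ≢ 0ℚ
ι-≢0 (suc n) eq with ℚ./-injective-≃ (mkℚᵘ (+ suc n) 0) (mkℚᵘ (+ 0) 0) eq
... | *≡* ()

-- Coefficients of finite sums of monomials

∑-t^ : ∀ {A : Set} (f : A → ℕ) xs k → ∑ (map (λ x → t^ f x) xs) k ≡ ι (length (filter (λ x → f x ≟ k) xs))
∑-t^ f []       k = refl
∑-t^ f (x ∷ xs) k with does (f x ≟ k)
... | true  = trans (cong (λ y → 1ℚ + y) (∑-t^ f xs k)) (sym (ι-+ 1 (length (filter (λ x → f x ≟ k) xs))))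
... | false = trans (ℚ.+-identityˡ _) (∑-t^ f xs k)

t^-same : ∀ k → (t^ k) k ≡ 1ℚ
t^-same k = cong (if_then 1ℚ else 0ℚ) (dec-true (k ≟ k) refl)

t^-other : ∀ {j k} → j ≢ k → (t^ j) k ≡ 0ℚ
t^-other {j} {k} j≢k = cong (if_then 1ℚ else 0ℚ) (dec-false (j ≟ k) j≢k)

module _ (c : ℕ → ℚ) where

  ∑-coeff-∉ : ∀ {k} xs → k ∉ xs → ∑ (map (λ i → c i · t^ i) xs) k ≡ 0ℚ
  ∑-coeff-∉ []       _  = refl
  ∑-coeff-∉ (x ∷ xs) k∉ = cong₂ _+_
    (trans (cong (c x *_) (t^-other (k∉ ∘ here ∘ sym))) (ℚ.*-zeroʳ (c x)))
    (∑-coeff-∉ xs (k∉ ∘ there))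

  ∑-coeff-∈ : ∀ {k xs} → Unique xs → k ∈ xs → ∑ (map (λ i → c i · t^ i) xs) k ≡ c k
  ∑-coeff-∈ {k} {_ ∷ xs} (x∉ ∷ _) (here refl) = trans
    (cong₂ _+_ (trans (cong (c k *_) (t^-same k)) (ℚ.*-identityʳ (c k)))
               (∑-coeff-∉ xs (λ k∈ → All.lookup x∉ k∈ refl)))
    (ℚ.+-identityʳ (c k))
  ∑-coeff-∈ {k} {x ∷ xs} (x∉ ∷ u) (there k∈) = trans
    (cong₂ _+_ (trans (cong (c x *_) (t^-other (All.lookup x∉ k∈))) (ℚ.*-zeroʳ (c x)))
               (∑-coeff-∈ u k∈))
    (ℚ.+-identityˡ (c k))

  -- From index `N` on the sum has coefficient 0, so `c` must vanish there; below `N` exactly one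
  -- summand contributes.
  ∑-coeff-upTo : ∀ N k → (N ≤ k → c k ≡ 0ℚ) → ∑ (map (λ i → c i · t^ i) (upTo N)) k ≡ c k
  ∑-coeff-upTo N k vanish with k ℕ.<? N
  ... | yes k<N = ∑-coeff-∈ (Unique.upTo⁺ N) (∈-upTo⁺ k<N)
  ... | no  k≮N = trans (∑-coeff-∉ (upTo N) (k≮N ∘ ∈-upTo⁻)) (sym (vanish (ℕ.≮⇒≥ k≮N)))

-- Catalan numbers

-- The common denominator of catalan k and of the k-th coefficient of ₂F₁(a,b;2;t).
κ : ℕ → ℚ
κ k = ι (suc k !) * ι (k !)

κ-≢0 : ∀ k → κ k ≢ 0ℚ
κ-≢0 k = *-≢0 (ι-≢0 (suc k !) {{suc k ℕ.!≢0}}) (ι-≢0 (k !) {{k ℕ.!≢0}})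

κ*catalan : ∀ k → κ k * catalan k ≡ ι ((2 ℕ.* k) !)
κ*catalan k = begin
  ι (suc k !) * ι (k !) * (1/[1+k] * c)
    ≡⟨ cong (λ x → x * ι (k !) * (1/[1+k] * c)) (ι-* (suc k) (k !)) ⟩
  ι (suc k) * ι (k !) * ι (k !) * (1/[1+k] * c)
    ≡⟨ solve 4 (λ n f i c → n :* f :* f :* (i :* c) := (n :* i) :* (c :* (f :* f))) refl
         (ι (suc k)) (ι (k !)) 1/[1+k] c ⟩
  (ι (suc k) * 1/[1+k]) * (c * (ι (k !) * ι (k !)))
    ≡⟨ cong (_* (c * (ι (k !) * ι (k !)))) (d*[i/d]≡i (+ 1) (suc k)) ⟩
  1ℚ * (c * (ι (k !) * ι (k !)))
    ≡⟨ ℚ.*-identityˡ _ ⟩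
  c * (ι (k !) * ι (k !))
    ≡⟨ cong (c *_) (ι-* (k !) (k !)) ⟨
  c * ι (k ! ℕ.* k !)
    ≡⟨ ι-* ((2 ℕ.* k) C k) (k ! ℕ.* k !) ⟨
  ι (((2 ℕ.* k) C k) ℕ.* (k ! ℕ.* k !))
    ≡⟨ cong ι (2kCk-! k) ⟩
  ι ((2 ℕ.* k) !) ∎
  where
  open ≡-Reasoning
  open ℚ-Solver
  1/[1+k] = + 1 / suc k
  c = ι ((2 ℕ.* k) C k)

-- Multiplied by `κ k`, both sides become (2k)!: the left by `ballot-!` at height 0, the right by
-- `κ*catalan`.
ι-ballot : ∀ k → ι (ballot 0 k) ≡ catalan k
ι-ballot k = *-cancelˡ (κ-≢0 k) (begin
  ι (suc k !) * ι (k !) * ι (ballot 0 k)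
    ≡⟨ solve 3 (λ x y z → x :* y :* z := z :* (y :* x)) refl (ι (suc k !)) (ι (k !)) (ι (ballot 0 k)) ⟩
  ι (ballot 0 k) * (ι (k !) * ι (suc k !))
    ≡⟨ cong (ι (ballot 0 k) *_) (ι-* (k !) (suc k !)) ⟨
  ι (ballot 0 k) * ι (k ! ℕ.* suc k !)
    ≡⟨ ι-* (ballot 0 k) (k ! ℕ.* suc k !) ⟨
  ι (ballot 0 k ℕ.* (k ! ℕ.* suc k !))
    ≡⟨ cong ι (trans (ballot-! 0 k (ℕ.+-identityʳ (2 ℕ.* k)) (cong suc (ℕ.+-identityʳ k)))
                     (ℕ.*-identityˡ ((2 ℕ.* k) !))) ⟩
  ι ((2 ℕ.* k) !)
    ≡⟨ κ*catalan k ⟨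
  κ k * catalan k ∎)
  where
  open ≡-Reasoning
  open ℚ-Solver

-- Pochhammer symbols and falling factorials

poch-2 : ∀ k → poch (ι 2) k ≡ ι (suc k !)
poch-2 zero    = refl
poch-2 (suc k) = begin
  poch (ι 2) k * (ι 2 + ι k)    ≡⟨ cong₂ _*_ (poch-2 k) (sym (ι-+ 2 k)) ⟩
  ι (suc k !) * ι (suc (suc k)) ≡⟨ ι-* (suc k !) (suc (suc k)) ⟨
  ι (suc k ! ℕ.* suc (suc k))   ≡⟨ cong ι (ℕ.*-comm (suc k !) (suc (suc k))) ⟩
  ι (suc (suc k) !)             ∎
  where open ≡-Reasoning

-- The falling factorial n(n-1)...(n-r+1). In this form `falling m (2 ℕ.* k)` is by definition the
-- binomial coefficient times (2k)!, as `₂F₁-coeff` needs it.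
falling : ℕ → ℕ → ℚ
falling n r = ι (n C r) * ι (r !)

falling-absorb : ∀ n r → falling n (suc r) + ι r * falling n r ≡ ι n * falling n r
falling-absorb n r = begin
  ι (n C suc r) * ι (suc r ℕ.* r !) + ι r * (ι (n C r) * ι (r !))
    ≡⟨ cong (λ x → ι (n C suc r) * x + ι r * (ι (n C r) * ι (r !))) (ι-* (suc r) (r !)) ⟩
  ι (n C suc r) * (ι (suc r) * ι (r !)) + ι r * (ι (n C r) * ι (r !))
    ≡⟨ solve 5 (λ b s f r a → b :* (s :* f) :+ r :* (a :* f) := (s :* b :+ r :* a) :* f) refl
         (ι (n C suc r)) (ι (suc r)) (ι (r !)) (ι r) (ι (n C r)) ⟩
  (ι (suc r) * ι (n C suc r) + ι r * ι (n C r)) * ι (r !)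
    ≡⟨ cong (_* ι (r !)) (cong₂ _+_ (ι-* (suc r) (n C suc r)) (ι-* r (n C r))) ⟨
  (ι (suc r ℕ.* (n C suc r)) + ι (r ℕ.* (n C r))) * ι (r !)
    ≡⟨ cong (_* ι (r !)) (ι-+ (suc r ℕ.* (n C suc r)) (r ℕ.* (n C r))) ⟨
  ι (suc r ℕ.* (n C suc r) ℕ.+ r ℕ.* (n C r)) * ι (r !)
    ≡⟨ cong (λ x → ι x * ι (r !)) (C-absorb n r) ⟨
  ι (n ℕ.* (n C r)) * ι (r !)
    ≡⟨ cong (_* ι (r !)) (ι-* n (n C r)) ⟩
  ι n * ι (n C r) * ι (r !)
    ≡⟨ ℚ.*-assoc (ι n) (ι (n C r)) (ι (r !)) ⟩
  ι n * falling n r ∎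
  where
  open ≡-Reasoning
  open ℚ-Solver

-- The factor n - r is taken in ℚ, so the rule holds for every `r`: both sides vanish for `r` at
-- least `n`. This covers the terms of the series with 2k > m as well.
falling-suc : ∀ n r → falling n (suc r) ≡ (ι n + - ι r) * falling n r
falling-suc n r = begin
  falling n (suc r)
    ≡⟨ solve 2 (λ x y → x := (x :+ y) :+ (:- y)) refl (falling n (suc r)) (ι r * falling n r) ⟩
  falling n (suc r) + ι r * falling n r + - (ι r * falling n r)
    ≡⟨ cong (_+ - (ι r * falling n r)) (falling-absorb n r) ⟩
  ι n * falling n r + - (ι r * falling n r)
    ≡⟨ solve 3 (λ n r x → n :* x :+ (:- (r :* x)) := (n :+ (:- r)) :* x) refl (ι n) (ι r) (falling n r) ⟩
  (ι n + - ι r) * falling n r ∎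
  where
  open ≡-Reasoning
  open ℚ-Solver

-- The coefficients of the three series

-- Doubling clears the denominator of the two upper parameters, where `i` is 1 or 2.
2*[i-n]/2 : ∀ i n → ι 2 * ((i - + n) / 2) ≡ i / 1 + - ι n
2*[i-n]/2 i n = begin
  ι 2 * ((i - + n) / 2)               ≡⟨ d*[i/d]≡i (i - + n) 2 ⟩
  (i - + n) / 1                       ≡⟨ solve 2 (λ x y → x := x :+ y :+ (:- y)) refl ((i - + n) / 1) (ι n) ⟩
  (i - + n) / 1 + ι n + - ι n         ≡⟨ cong (_+ - ι n) (/1-homo-+ (i - + n) (+ n)) ⟨
  ((i - + n) ℤ.+ + n) / 1 + - ι n     ≡⟨ cong (λ j → j / 1 + - ι n) [i-n]+n≡i ⟩
  i / 1 + - ι n                       ∎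
  where
  open ≡-Reasoning
  open ℚ-Solver
  [i-n]+n≡i : (i - + n) ℤ.+ + n ≡ i
  [i-n]+n≡i = trans (ℤ.+-assoc i (ℤ.- + n) (+ n))
    (trans (cong (λ j → i ℤ.+ j) (ℤ.+-inverseˡ (+ n))) (ℤ.+-identityʳ i))

⌊m/2⌋<k⇒m<2k : ∀ m k → ⌊ m /2⌋ < k → m < 2 ℕ.* k
⌊m/2⌋<k⇒m<2k zero          (suc k) _           = s≤s z≤n
⌊m/2⌋<k⇒m<2k (suc zero)    (suc k) _           rewrite ℕ.*-suc 2 k = s≤s (s≤s z≤n)
⌊m/2⌋<k⇒m<2k (suc (suc m)) (suc k) (s≤s h) rewrite ℕ.*-suc 2 k = s≤s (s≤s (⌊m/2⌋<k⇒m<2k m k h))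

module _ (m : ℕ) where

  private
    a b : ℚ
    a = (+ 1 - + suc m) / 2
    b = (+ 2 - + suc m) / 2

  2a≡-m : ι 2 * a ≡ - ι m
  2a≡-m = begin
    ι 2 * a               ≡⟨ 2*[i-n]/2 (+ 1) (suc m) ⟩
    1ℚ + - ι (suc m)      ≡⟨ cong (λ x → 1ℚ + - x) (ι-+ 1 m) ⟩
    1ℚ + - (1ℚ + ι m)     ≡⟨ solve 2 (λ u m → u :+ (:- (u :+ m)) := :- m) refl 1ℚ (ι m) ⟩
    - ι m                 ∎
    where
    open ≡-Reasoning
    open ℚ-Solver

  2b≡1-m : ι 2 * b ≡ 1ℚ + - ι m
  2b≡1-m = begin
    ι 2 * b                  ≡⟨ 2*[i-n]/2 (+ 2) (suc m) ⟩
    -- The solver treats `1ℚ` as a variable, so 2 is split into 1 + 1.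
    ι 2 + - ι (suc m)        ≡⟨ cong₂ (λ x y → x + - y) (ι-+ 1 1) (ι-+ 1 m) ⟩
    1ℚ + 1ℚ + - (1ℚ + ι m)   ≡⟨ solve 2 (λ u m → u :+ u :+ (:- (u :+ m)) := u :+ (:- m)) refl 1ℚ (ι m) ⟩
    1ℚ + - ι m               ∎
    where
    open ≡-Reasoning
    open ℚ-Solver

  -- The factor 4 of each step is shared between the two symbols: 2(a+k) = -(m-2k) and 2(b+k) =
  -- -(m-2k-1). The signs cancel, leaving the next two factors of the falling factorial.
  4^k-poch-poch : ∀ k → _^_ +-*-rawSemiring (ι 4) k * (poch a k * poch b k) ≡ falling m (2 ℕ.* k)
  4^k-poch-poch zero    = refl
  4^k-poch-poch (suc k) = begin
    ι 4 * E * (A * (a + ι k) * (B * (b + ι k)))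
      ≡⟨ cong (λ x → x * E * (A * (a + ι k) * (B * (b + ι k)))) (ι-* 2 2) ⟩
    ι 2 * ι 2 * E * (A * (a + ι k) * (B * (b + ι k)))
      ≡⟨ solve 7 (λ t e x y a b k →
           t :* t :* e :* (x :* (a :+ k) :* (y :* (b :+ k)))
           := (t :* b :+ t :* k) :* ((t :* a :+ t :* k) :* (e :* (x :* y)))) refl
           (ι 2) E A B a b (ι k) ⟩
    (ι 2 * b + ι 2 * ι k) * ((ι 2 * a + ι 2 * ι k) * (E * (A * B)))
      ≡⟨ cong₂ (λ x y → (x + ι 2 * ι k) * ((y + ι 2 * ι k) * (E * (A * B)))) 2b≡1-m 2a≡-m ⟩
    (1ℚ + - ι m + ι 2 * ι k) * ((- ι m + ι 2 * ι k) * (E * (A * B)))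
      ≡⟨ cong₂ (λ x y → (1ℚ + - ι m + x) * ((- ι m + x) * y)) (sym (ι-* 2 k)) (4^k-poch-poch k) ⟩
    (1ℚ + - ι m + ι r) * ((- ι m + ι r) * falling m r)
      ≡⟨ solve 4 (λ u m r f → (u :+ (:- m) :+ r) :* (((:- m) :+ r) :* f)
           := (m :+ (:- (u :+ r))) :* ((m :+ (:- r)) :* f)) refl 1ℚ (ι m) (ι r) (falling m r) ⟩
    (ι m + - (1ℚ + ι r)) * ((ι m + - ι r) * falling m r)
      ≡⟨ cong₂ (λ x y → (ι m + - x) * y) (ι-+ 1 r) (falling-suc m r) ⟨
    (ι m + - ι (suc r)) * falling m (suc r)
      ≡⟨ falling-suc m (suc r) ⟨
    falling m (suc (suc r))
      ≡⟨ cong (falling m) (ℕ.*-suc 2 k) ⟨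
    falling m (2 ℕ.* suc k) ∎
    where
    open ≡-Reasoning
    open ℚ-Solver
    E = _^_ +-*-rawSemiring (ι 4) k
    A = poch a k
    B = poch b k
    r = 2 ℕ.* k

  -- Since `κ k` is (2)ₖ times k!, multiplying by it clears both denominators of the hypergeometric
  -- coefficient.
  ₂F₁-coeff : ∀ k → ι (m C (2 ℕ.* k)) * catalan k ≡ (₂F₁ a b (ι 2) ι2-admissible [ ι 4 ·t]) k
  ₂F₁-coeff k = *-cancelˡ (κ-≢0 k) (begin
    κ k * (c * catalan k)
      ≡⟨ solve 3 (λ x c y → x :* (c :* y) := c :* (x :* y)) refl (κ k) c (catalan k) ⟩
    c * (κ k * catalan k)
      ≡⟨ cong (c *_) (κ*catalan k) ⟩
    falling m (2 ℕ.* k)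
      ≡⟨ 4^k-poch-poch k ⟨
    E * AB
      ≡⟨ cong (E *_) (*-÷ AB (poch (ι 2) k) p≢0) ⟨
    E * (poch (ι 2) k * Q)
      ≡⟨ cong (λ x → E * (x * Q)) (poch-2 k) ⟩
    E * (ι (suc k !) * Q)
      -- The inserted 1 is replaced by `ι (k !) * 1/k!`, which supplies the second factor of `κ k`
      -- and the 1/k! of the coefficient.
      ≡⟨ ℚ.*-identityˡ _ ⟨
    1ℚ * (E * (ι (suc k !) * Q))
      ≡⟨ cong (_* (E * (ι (suc k !) * Q))) (d*[i/d]≡i (+ 1) (k !) {{k ℕ.!≢0}}) ⟨
    ι (k !) * 1/k! * (E * (ι (suc k !) * Q))
      ≡⟨ solve 5 (λ f i e g q → f :* i :* (e :* (g :* q)) := g :* f :* (e :* (q :* i))) refl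
           (ι (k !)) 1/k! E (ι (suc k !)) Q ⟩
    κ k * (E * (Q * 1/k!)) ∎)
    where
    open ≡-Reasoning
    open ℚ-Solver
    p≢0 = poch-≢0 ι2-admissible k
    c = ι (m C (2 ℕ.* k))
    E = _^_ +-*-rawSemiring (ι 4) k
    AB = poch a k * poch b k
    Q = (AB ÷ poch (ι 2) k) {{≢-nonZero p≢0}}
    1/k! = _/_ (+ 1) (k !) {{k ℕ.!≢0}}

  asc-coeff : ∀ k → asc[MP suc m ] k ≡ ι (m C (2 ℕ.* k)) * catalan k
  asc-coeff k = begin
    asc[MP suc m ] k
      ≡⟨ ∑-t^ asc (MP (suc m)) k ⟩
    ι (length (filter (λ w → asc w ≟ k) (MP (suc m))))
      ≡⟨ cong ι (↭-length (MP-asc↭paths m k)) ⟩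
    ι (length (paths m 0 k))
      ≡⟨ cong ι (length-paths m 0 k (ℕ.+-identityʳ (2 ℕ.* k))) ⟩
    ι ((m C (2 ℕ.* k)) ℕ.* ballot 0 k)
      ≡⟨ ι-* (m C (2 ℕ.* k)) (ballot 0 k) ⟩
    ι (m C (2 ℕ.* k)) * ι (ballot 0 k)
      ≡⟨ cong (ι (m C (2 ℕ.* k)) *_) (ι-ballot k) ⟩
    ι (m C (2 ℕ.* k)) * catalan k ∎
    where open ≡-Reasoning

  S-coeff : ∀ k → ∑ (map (λ i → (ι (m C (2 ℕ.* i)) * catalan i) · t^ i) (upTo (suc ⌊ m /2⌋))) k
                  ≡ ι (m C (2 ℕ.* k)) * catalan k
  S-coeff k = ∑-coeff-upTo (λ i → ι (m C (2 ℕ.* i)) * catalan i) (suc ⌊ m /2⌋) k λ h →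
    -- Beyond the range of summation 2k exceeds `m`, and the binomial coefficient is 0.
    trans (cong (λ x → ι x * catalan k) (k>n⇒nCk≡0 (⌊m/2⌋<k⇒m<2k m k h))) (ℚ.*-zeroˡ (catalan k))

theorem6p10 : ∀ n .{{_ : NonZero n}} →
    let S = ∑ (map (λ i → (ι ((n ∸ 1) C (2 ℕ.* i)) * catalan i) · t^ i) (upTo (suc ⌊ n ∸ 1 /2⌋)))
    in (asc[MP n ] ≗ S)
    × (S ≗ ₂F₁ ((+ 1 - + n) / 2) ((+ 2 - + n) / 2) (ι 2) ι2-admissible [ ι 4 ·t])
theorem6p10 (suc m) =
    (λ k → trans (asc-coeff m k) (sym (S-coeff m k)))
  , (λ k → trans (S-coeff m k) (₂F₁-coeff m k))
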